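{- Let $\mathbb F_q$ be a finite field of characteristic $2$, let $n$ be a positive integer, and let $\chi$ be a nontrivial additive character of $\mathbb F_{q^n}$. A polynomial $f$ over $\mathbb F_{q^n}$ is a permutation polynomial of $\mathbb F_{q^n}$ if and only if $\sum_{v\in\mathbb F_{q^n}}\chi(uf(v))=0$ for every $u\in\mathbb F_{q^n}^*$.
   Context: A polynomial over $\mathbb F_{q^n}$ is called a permutation polynomial of $\mathbb F_{q^n}$ if the map $v\mapsto f(v)$ it defines on $\mathbb F_{q^n}$ is a bijection. An additive character of $\mathbb F_{q^n}$ is a homomorphism from $(\mathbb F_{q^n},+)$ to $\mathbb C^*$. -}

module Defs where

open import Level using (Level; 0ℓ; _⊔_; suc)
open import Algebra.Bundles using (CommutativeRing; Group)
import Algebra.Definitions as AlgebraDefinitions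
import Algebra.Definitions.RawMonoid as RawMonoidDefinitions
open import Algebra.Morphism.Bundles using (GroupHomomorphism)
open import Algebra.Structures using (IsCommutativeRing; IsGroup)
open import Data.Fin.Base using (Fin)
open import Data.List.Base using (List; foldr)
open import Data.Nat.Base as ℕ using (ℕ; zero)
import Data.Nat.Properties as ℕ
open import Data.Nat.Divisibility using (_∣_)
open import Data.Product.Base using (Σ; ∃; _×_; _,_; proj₁; proj₂; uncurry)
open import Data.Rational.Base as ℚ using (ℚ; 0ℚ; 1ℚ; ½)
import Data.Rational.Properties as ℚ
open import Data.Rational.Solver using (module +-*-Solver)
open import Data.Sum.Base using (inj₁; inj₂)
open import Function.Base using (id; const)
open import Function.Bundles using (Inverse; _⇔_)
open import Function.Definitions using (Bijective)
open import Relation.Binary.PropositionalEquality as ≡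
  using (_≡_; _≗_; cong; cong₂; subst)
open import Relation.Binary.Structures using (IsEquivalence)
open import Relation.Nullary.Negation using (¬_)

private
  variable
    c ℓ : Level

module _ (R : CommutativeRing c ℓ) where
  open CommutativeRing R
  open RawMonoidDefinitions +-rawMonoid using () renaming (_×_ to _·_)

  -- p generates the kernel of ℤ → R; for p > 0 this says that p is the
  -- least positive m with m · 1 = 0.
  HasCharacteristic : ℕ → Set ℓ
  HasCharacteristic p = ∀ m → (m · 1# ≈ 0#) ⇔ (p ∣ m)

record FiniteField (c ℓ : Level) (q : ℕ) : Set (suc (c ⊔ ℓ)) where
  field
    commutativeRing : CommutativeRing c ℓ

  open CommutativeRing commutativeRing public
  open AlgebraDefinitions _≈_ using (Invertible)

  field
    1≉0            : ¬ (1# ≈ 0#)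
    ≉0⇒invertible : ∀ x → ¬ (x ≈ 0#) → Invertible 1# _*_ x
    enumeration    : Inverse (≡.setoid (Fin q)) setoid

  element : Fin q → Carrier
  element = Inverse.to enumeration

module _ {q : ℕ} (F : FiniteField c ℓ q) where
  open FiniteField F

  -- Coefficients are listed from the constant term upwards; trailing zeros
  -- are allowed.
  Polynomial : Set c
  Polynomial = List Carrier

  eval : Polynomial → Carrier → Carrier
  eval f v = foldr (λ a r → a + v * r) 0# f

  IsPermutationPolynomial : Polynomial → Set (c ⊔ ℓ)
  IsPermutationPolynomial f = Bijective _≈_ _≈_ (eval f)

0<1 : 0ℚ ℚ.< 1ℚ
0<1 = ℚ.positive⁻¹ 1ℚ

p≤q+p : ∀ q p → 0ℚ ℚ.≤ q → p ℚ.≤ q ℚ.+ p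
p≤q+p q p 0≤q = subst (ℚ._≤ q ℚ.+ p) (ℚ.+-identityˡ p) (ℚ.+-monoˡ-≤ p 0≤q)

p≤p+q : ∀ p q → 0ℚ ℚ.≤ q → p ℚ.≤ p ℚ.+ q
p≤p+q p q 0≤q = subst (ℚ._≤ p ℚ.+ q) (ℚ.+-identityʳ p) (ℚ.+-monoʳ-≤ p 0≤q)

half-pos : ∀ {ε} → 0ℚ ℚ.< ε → 0ℚ ℚ.< ½ ℚ.* ε
half-pos {ε} 0<ε = ℚ.positive⁻¹ (½ ℚ.* ε) {{ℚ.pos*pos⇒pos ½ ε {{ℚ.positive 0<ε}}}}

half+half : ∀ ε → ½ ℚ.* ε ℚ.+ ½ ℚ.* ε ≡ ε
half+half ε = ≡.trans (≡.sym (ℚ.*-distribʳ-+ ε ½ ½)) (ℚ.*-identityˡ ε)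

Bounded : {I : Set} → (I → ℚ) → Set
Bounded f = ∃ λ B → 0ℚ ℚ.< B × (∀ i → ℚ.∣ f i ∣ ℚ.≤ B)

-- h measures how far along an index lies: the identity for a sequence,
-- the minimum of the two indices for a family over ℕ × ℕ.
module Null {I : Set} (h : I → ℕ) where

  record Null (f : I → ℚ) : Set where
    constructor mkNull
    field
      vanish : ∀ ε → 0ℚ ℚ.< ε → ∃ λ N → ∀ i → N ℕ.≤ h i → ℚ.∣ f i ∣ ℚ.< ε

  open Null public

  null-resp : ∀ {f g} → f ≗ g → Null f → Null g
  null-resp f≗g nf .vanish ε 0<ε with vanish nf ε 0<ε
  ... | N , p = N , λ i N≤i → subst (λ x → ℚ.∣ x ∣ ℚ.< ε) (f≗g i) (p i N≤i)

  null-0 : Null (const 0ℚ)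
  null-0 .vanish ε 0<ε = 0 , λ _ _ → 0<ε

  null-+ : ∀ {f g} → Null f → Null g → Null (λ i → f i ℚ.+ g i)
  null-+ {f} {g} nf ng .vanish ε 0<ε
    with vanish nf _ (half-pos 0<ε) | vanish ng _ (half-pos 0<ε)
  ... | M , p | N , r = M ℕ.⊔ N , λ i M⊔N≤i →
    ℚ.≤-<-trans (ℚ.∣p+q∣≤∣p∣+∣q∣ (f i) (g i))
      (subst (_ ℚ.<_) (half+half ε)
        (ℚ.+-mono-< (p i (ℕ.m⊔n≤o⇒m≤o M N M⊔N≤i))
                    (r i (ℕ.m⊔n≤o⇒n≤o M N M⊔N≤i))))

  null-neg : ∀ {f} → Null f → Null (λ i → ℚ.- f i)
  null-neg {f} nf .vanish ε 0<ε with vanish nf ε 0<ε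
  ... | N , p = N , λ i N≤i →
    subst (ℚ._< ε) (≡.sym (ℚ.∣-p∣≡∣p∣ (f i))) (p i N≤i)

  null-* : ∀ {f g} → Bounded f → Null g → Null (λ i → f i ℚ.* g i)
  null-* {f} {g} (B , 0<B , f≤B) ng .vanish ε 0<ε = proj₁ small , bound
    where
    instance
      posB = ℚ.positive 0<B
      posε = ℚ.positive 0<ε
      nzB  = ℚ.pos⇒nonZero B
      posB⁻¹ = ℚ.1/pos⇒pos B

    δ : ℚ
    δ = ℚ.1/ B ℚ.* ε

    small = vanish ng δ (ℚ.positive⁻¹ δ {{ℚ.pos*pos⇒pos (ℚ.1/ B) ε}})

    Bδ≡ε : B ℚ.* δ ≡ ε
    Bδ≡ε = ≡.trans (≡.sym (ℚ.*-assoc B (ℚ.1/ B) ε))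
             (≡.trans (cong (ℚ._* ε) (ℚ.*-inverseʳ B)) (ℚ.*-identityˡ ε))

    bound : ∀ i → proj₁ small ℕ.≤ h i → ℚ.∣ f i ℚ.* g i ∣ ℚ.< ε
    bound i N≤i = begin-strict
      ℚ.∣ f i ℚ.* g i ∣         ≡⟨ ℚ.∣p*q∣≡∣p∣*∣q∣ (f i) (g i) ⟩
      ℚ.∣ f i ∣ ℚ.* ℚ.∣ g i ∣   ≤⟨ ℚ.*-monoʳ-≤-nonNeg ℚ.∣ g i ∣ {{ℚ.∣-∣-nonNeg (g i)}} (f≤B i) ⟩
      B ℚ.* ℚ.∣ g i ∣           <⟨ ℚ.*-monoʳ-<-pos B (proj₂ small i N≤i) ⟩
      B ℚ.* δ                   ≡⟨ Bδ≡ε ⟩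
      ε                         ∎
      where open ℚ.≤-Reasoning

-- Real numbers: Cauchy sequences of rationals, where two sequences are
-- equal when their difference tends to 0

IsCauchy : (ℕ → ℚ) → Set
IsCauchy x = ∀ ε → 0ℚ ℚ.< ε →
  ∃ λ N → ∀ m n → N ℕ.≤ m → N ℕ.≤ n → ℚ.∣ x m ℚ.- x n ∣ ℚ.< ε

record ℝ : Set where
  no-eta-equality
  field
    seq    : ℕ → ℚ
    cauchy : IsCauchy seq

open ℝ public

infix 4 _≈ᴿ_

record _≈ᴿ_ (x y : ℝ) : Set where
  constructor mk≈
  field
    converge : ∀ ε → 0ℚ ℚ.< ε →
      ∃ λ N → ∀ n → N ℕ.≤ n → ℚ.∣ seq x n ℚ.- seq y n ∣ ℚ.< ε

open _≈ᴿ_ public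

module N₁ = Null {ℕ} id
module N₂ = Null {ℕ × ℕ} (uncurry ℕ._⊓_)

toNull₂ : ∀ x → IsCauchy x → N₂.Null (λ (m , n) → x m ℚ.- x n)
toNull₂ x cx .N₂.vanish ε 0<ε with cx ε 0<ε
... | N , p = N , λ (m , n) N≤ → p m n (ℕ.m≤n⊓o⇒m≤n m n N≤) (ℕ.m≤n⊓o⇒m≤o m n N≤)

fromNull₂ : ∀ x → N₂.Null (λ (m , n) → x m ℚ.- x n) → IsCauchy x
fromNull₂ x nx ε 0<ε with N₂.vanish nx ε 0<ε
... | N , p = N , λ m n N≤m N≤n → p (m , n) (ℕ.⊓-glb N≤m N≤n)

prefixBound : ∀ (x : ℕ → ℚ) N →
  ∃ λ B → 0ℚ ℚ.< B × (∀ n → n ℕ.≤ N → ℚ.∣ x n ∣ ℚ.≤ B)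
prefixBound x zero = 1ℚ ℚ.+ ℚ.∣ x 0 ∣
  , ℚ.+-mono-<-≤ 0<1 (ℚ.0≤∣p∣ (x 0))
  , λ { .0 ℕ.z≤n → p≤q+p 1ℚ ℚ.∣ x 0 ∣ (ℚ.<⇒≤ 0<1) }
prefixBound x (ℕ.suc N) with prefixBound x N
... | B , 0<B , p = B ℚ.+ ℚ.∣ x (ℕ.suc N) ∣
  , ℚ.+-mono-<-≤ 0<B (ℚ.0≤∣p∣ (x (ℕ.suc N)))
  , bound
  where
  bound : ∀ n → n ℕ.≤ ℕ.suc N → ℚ.∣ x n ∣ ℚ.≤ B ℚ.+ ℚ.∣ x (ℕ.suc N) ∣
  bound n n≤1+N with ℕ.m≤n⇒m<n∨m≡n n≤1+N
  ... | inj₁ (ℕ.s≤s n≤N) = ℚ.≤-trans (p n n≤N)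
    (p≤p+q B ℚ.∣ x (ℕ.suc N) ∣ (ℚ.0≤∣p∣ (x (ℕ.suc N))))
  ... | inj₂ ≡.refl = p≤q+p B ℚ.∣ x n ∣ (ℚ.<⇒≤ 0<B)

cauchy⇒bounded : ∀ x → IsCauchy x → Bounded x
cauchy⇒bounded x cx with cx 1ℚ 0<1
... | N , p with prefixBound x N
... | B , 0<B , r = 1ℚ ℚ.+ B , ℚ.+-mono-< 0<1 0<B , bound
  where
  open +-*-Solver
  bound : ∀ n → ℚ.∣ x n ∣ ℚ.≤ 1ℚ ℚ.+ B
  bound n with ℕ.≤-total n N
  ... | inj₁ n≤N = ℚ.≤-trans (r n n≤N) (p≤q+p 1ℚ B (ℚ.<⇒≤ 0<1))
  ... | inj₂ N≤n = begin
    ℚ.∣ x n ∣                                ≡⟨ cong ℚ.∣_∣ (solve 2 (λ a b → a := (a :- b) :+ b) ≡.refl (x n) (x N)) ⟩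
    ℚ.∣ (x n ℚ.- x N) ℚ.+ x N ∣              ≤⟨ ℚ.∣p+q∣≤∣p∣+∣q∣ (x n ℚ.- x N) (x N) ⟩
    ℚ.∣ x n ℚ.- x N ∣ ℚ.+ ℚ.∣ x N ∣          ≤⟨ ℚ.+-mono-≤ (ℚ.<⇒≤ (p n N N≤n ℕ.≤-refl)) (r N ℕ.≤-refl) ⟩
    1ℚ ℚ.+ B                                 ∎
    where open ℚ.≤-Reasoning

module Rational where
  open +-*-Solver

  sum-difference : ∀ a a′ b b′ →
    (a ℚ.- a′) ℚ.+ (b ℚ.- b′) ≡ (a ℚ.+ b) ℚ.- (a′ ℚ.+ b′)
  sum-difference = solve 4 (λ a a′ b b′ →
    (a :- a′) :+ (b :- b′) := (a :+ b) :- (a′ :+ b′)) ≡.refl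

  product-difference : ∀ a a′ b b′ →
    a ℚ.* (b ℚ.- b′) ℚ.+ b′ ℚ.* (a ℚ.- a′) ≡ a ℚ.* b ℚ.- a′ ℚ.* b′
  product-difference = solve 4 (λ a a′ b b′ →
    a :* (b :- b′) :+ b′ :* (a :- a′) := a :* b :- a′ :* b′) ≡.refl

  difference-swap : ∀ a b → ℚ.- (a ℚ.- b) ≡ b ℚ.- a
  difference-swap = solve 2 (λ a b → :- (a :- b) := b :- a) ≡.refl

  difference-trans : ∀ a b c → (a ℚ.- b) ℚ.+ (b ℚ.- c) ≡ a ℚ.- c
  difference-trans = solve 3 (λ a b c → (a :- b) :+ (b :- c) := a :- c) ≡.refl

  *-comm-re : ∀ a b c d → a ℚ.* c ℚ.- b ℚ.* d ≡ c ℚ.* a ℚ.- d ℚ.* b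
  *-comm-re = solve 4 (λ a b c d → a :* c :- b :* d := c :* a :- d :* b) ≡.refl

  *-comm-im : ∀ a b c d → a ℚ.* d ℚ.+ b ℚ.* c ≡ c ℚ.* b ℚ.+ d ℚ.* a
  *-comm-im = solve 4 (λ a b c d → a :* d :+ b :* c := c :* b :+ d :* a) ≡.refl

  *-assoc-re : ∀ a b c d e f →
    (a ℚ.* c ℚ.- b ℚ.* d) ℚ.* e ℚ.- (a ℚ.* d ℚ.+ b ℚ.* c) ℚ.* f
      ≡ a ℚ.* (c ℚ.* e ℚ.- d ℚ.* f) ℚ.- b ℚ.* (c ℚ.* f ℚ.+ d ℚ.* e)
  *-assoc-re = solve 6 (λ a b c d e f →
    (a :* c :- b :* d) :* e :- (a :* d :+ b :* c) :* f
      := a :* (c :* e :- d :* f) :- b :* (c :* f :+ d :* e)) ≡.refl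

  *-assoc-im : ∀ a b c d e f →
    (a ℚ.* c ℚ.- b ℚ.* d) ℚ.* f ℚ.+ (a ℚ.* d ℚ.+ b ℚ.* c) ℚ.* e
      ≡ a ℚ.* (c ℚ.* f ℚ.+ d ℚ.* e) ℚ.+ b ℚ.* (c ℚ.* e ℚ.- d ℚ.* f)
  *-assoc-im = solve 6 (λ a b c d e f →
    (a :* c :- b :* d) :* f :+ (a :* d :+ b :* c) :* e
      := a :* (c :* f :+ d :* e) :+ b :* (c :* e :- d :* f)) ≡.refl

  *-identity-re : ∀ a b → 1ℚ ℚ.* a ℚ.- 0ℚ ℚ.* b ≡ a
  *-identity-re = solve 2 (λ a b → con 1ℚ :* a :- con 0ℚ :* b := a) ≡.refl

  *-identity-im : ∀ a b → 1ℚ ℚ.* b ℚ.+ 0ℚ ℚ.* a ≡ b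
  *-identity-im = solve 2 (λ a b → con 1ℚ :* b :+ con 0ℚ :* a := b) ≡.refl

  *-distrib-re : ∀ a b c d e f →
    a ℚ.* (c ℚ.+ e) ℚ.- b ℚ.* (d ℚ.+ f)
      ≡ (a ℚ.* c ℚ.- b ℚ.* d) ℚ.+ (a ℚ.* e ℚ.- b ℚ.* f)
  *-distrib-re = solve 6 (λ a b c d e f →
    a :* (c :+ e) :- b :* (d :+ f)
      := (a :* c :- b :* d) :+ (a :* e :- b :* f)) ≡.refl

  *-distrib-im : ∀ a b c d e f →
    a ℚ.* (d ℚ.+ f) ℚ.+ b ℚ.* (c ℚ.+ e)
      ≡ (a ℚ.* d ℚ.+ b ℚ.* c) ℚ.+ (a ℚ.* f ℚ.+ b ℚ.* e)
  *-distrib-im = solve 6 (λ a b c d e f →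
    a :* (d :+ f) :+ b :* (c :+ e)
      := (a :* d :+ b :* c) :+ (a :* f :+ b :* e)) ≡.refl

null⇒≈ : ∀ {x y} → N₁.Null (λ n → seq x n ℚ.- seq y n) → x ≈ᴿ y
null⇒≈ nxy = mk≈ (N₁.vanish nxy)

≈⇒null : ∀ {x y} → x ≈ᴿ y → N₁.Null (λ n → seq x n ℚ.- seq y n)
≈⇒null x≈y = N₁.mkNull (converge x≈y)

≗⇒≈ : ∀ {x y} → seq x ≗ seq y → x ≈ᴿ y
≗⇒≈ {x} {y} e = null⇒≈ (N₁.null-resp
  (λ n → ≡.sym (≡.trans (cong (ℚ._- seq y n) (e n)) (ℚ.+-inverseʳ (seq y n)))) N₁.null-0)

private abstract

  const-cauchy : ∀ p → IsCauchy (const p)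
  const-cauchy p = fromNull₂ (const p)
    (N₂.null-resp (λ _ → ≡.sym (ℚ.+-inverseʳ p)) N₂.null-0)

  +-cauchy : ∀ x y → IsCauchy x → IsCauchy y → IsCauchy (λ n → x n ℚ.+ y n)
  +-cauchy x y cx cy = fromNull₂ (λ n → x n ℚ.+ y n) (N₂.null-resp
    (λ (m , n) → Rational.sum-difference (x m) (x n) (y m) (y n))
    (N₂.null-+ (toNull₂ x cx) (toNull₂ y cy)))

  neg-cauchy : ∀ x → IsCauchy x → IsCauchy (λ n → ℚ.- x n)
  neg-cauchy x cx = fromNull₂ (λ n → ℚ.- x n) (N₂.null-resp
    (λ (m , n) → ℚ.neg-distrib-+ (x m) (ℚ.- x n)) (N₂.null-neg (toNull₂ x cx)))

  *-cauchy : ∀ x y → IsCauchy x → IsCauchy y → IsCauchy (λ n → x n ℚ.* y n)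
  *-cauchy x y cx cy = fromNull₂ (λ n → x n ℚ.* y n) (N₂.null-resp
    (λ (m , n) → Rational.product-difference (x m) (x n) (y m) (y n))
    (N₂.null-+ (N₂.null-* (reindex proj₁ (cauchy⇒bounded x cx)) (toNull₂ y cy))
               (N₂.null-* (reindex proj₂ (cauchy⇒bounded y cy)) (toNull₂ x cx))))
    where
    reindex : ∀ {z : ℕ → ℚ} (π : ℕ × ℕ → ℕ) → Bounded z → Bounded (λ i → z (π i))
    reindex π (B , 0<B , z≤B) = B , 0<B , λ i → z≤B (π i)

infix  8 -ᴿ_
infixl 7 _*ᴿ_
infixl 6 _+ᴿ_

fromℚ : ℚ → ℝ
fromℚ p .seq    = const p
fromℚ p .cauchy = const-cauchy p

_+ᴿ_ : ℝ → ℝ → ℝ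
(x +ᴿ y) .seq n  = seq x n ℚ.+ seq y n
(x +ᴿ y) .cauchy = +-cauchy (seq x) (seq y) (cauchy x) (cauchy y)

-ᴿ_ : ℝ → ℝ
(-ᴿ x) .seq n  = ℚ.- seq x n
(-ᴿ x) .cauchy = neg-cauchy (seq x) (cauchy x)

_*ᴿ_ : ℝ → ℝ → ℝ
(x *ᴿ y) .seq n  = seq x n ℚ.* seq y n
(x *ᴿ y) .cauchy = *-cauchy (seq x) (seq y) (cauchy x) (cauchy y)

≈ᴿ-isEquivalence : IsEquivalence _≈ᴿ_
≈ᴿ-isEquivalence = record
  { refl  = ≗⇒≈ (λ _ → ≡.refl)
  ; sym   = λ {x} {y} x≈y → null⇒≈ (N₁.null-resp
      (λ n → Rational.difference-swap (seq x n) (seq y n))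
      (N₁.null-neg (≈⇒null x≈y)))
  ; trans = λ {x} {y} {z} x≈y y≈z → null⇒≈ (N₁.null-resp
      (λ n → Rational.difference-trans (seq x n) (seq y n) (seq z n))
      (N₁.null-+ (≈⇒null x≈y) (≈⇒null y≈z)))
  }

private
  +ᴿ-cong : ∀ {x x′ y y′} → x ≈ᴿ x′ → y ≈ᴿ y′ → x +ᴿ y ≈ᴿ x′ +ᴿ y′
  +ᴿ-cong {x} {x′} {y} {y′} p r = null⇒≈ (N₁.null-resp
    (λ n → Rational.sum-difference (seq x n) (seq x′ n) (seq y n) (seq y′ n))
    (N₁.null-+ (≈⇒null p) (≈⇒null r)))

  -ᴿ-cong : ∀ {x y} → x ≈ᴿ y → -ᴿ x ≈ᴿ -ᴿ y
  -ᴿ-cong {x} {y} p = null⇒≈ (N₁.null-resp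
    (λ n → ℚ.neg-distrib-+ (seq x n) (ℚ.- seq y n)) (N₁.null-neg (≈⇒null p)))

  *ᴿ-cong : ∀ {x x′ y y′} → x ≈ᴿ x′ → y ≈ᴿ y′ → x *ᴿ y ≈ᴿ x′ *ᴿ y′
  *ᴿ-cong {x} {x′} {y} {y′} p r = null⇒≈ (N₁.null-resp
    (λ n → Rational.product-difference (seq x n) (seq x′ n) (seq y n) (seq y′ n))
    (N₁.null-+ (N₁.null-* (cauchy⇒bounded (seq x) (cauchy x)) (≈⇒null r))
               (N₁.null-* (cauchy⇒bounded (seq y′) (cauchy y′)) (≈⇒null p))))

ℝ-isCommutativeRing :
  IsCommutativeRing _≈ᴿ_ _+ᴿ_ _*ᴿ_ -ᴿ_ (fromℚ 0ℚ) (fromℚ 1ℚ)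
ℝ-isCommutativeRing = record
  { isRing = record
    { +-isAbelianGroup = record
      { isGroup = record
        { isMonoid = record
          { isSemigroup = record
            { isMagma = record { isEquivalence = ≈ᴿ-isEquivalence ; ∙-cong = +ᴿ-cong }
            ; assoc = λ x y z → ≗⇒≈ λ n → ℚ.+-assoc (seq x n) (seq y n) (seq z n)
            }
          ; identity = (λ x → ≗⇒≈ λ n → ℚ.+-identityˡ (seq x n))
                     , (λ x → ≗⇒≈ λ n → ℚ.+-identityʳ (seq x n))
          }
        ; inverse = (λ x → ≗⇒≈ λ n → ℚ.+-inverseˡ (seq x n))
                  , (λ x → ≗⇒≈ λ n → ℚ.+-inverseʳ (seq x n))
        ; ⁻¹-cong = -ᴿ-cong
        }
      ; comm = λ x y → ≗⇒≈ λ n → ℚ.+-comm (seq x n) (seq y n)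
      }
    ; *-cong = *ᴿ-cong
    ; *-assoc = λ x y z → ≗⇒≈ λ n → ℚ.*-assoc (seq x n) (seq y n) (seq z n)
    ; *-identity = (λ x → ≗⇒≈ λ n → ℚ.*-identityˡ (seq x n))
                 , (λ x → ≗⇒≈ λ n → ℚ.*-identityʳ (seq x n))
    ; distrib = (λ x y z → ≗⇒≈ λ n → ℚ.*-distribˡ-+ (seq x n) (seq y n) (seq z n))
              , (λ x y z → ≗⇒≈ λ n → ℚ.*-distribʳ-+ (seq x n) (seq y n) (seq z n))
    }
  ; *-comm = λ x y → ≗⇒≈ λ n → ℚ.*-comm (seq x n) (seq y n)
  }

ℝ-commutativeRing : CommutativeRing 0ℓ 0ℓ
ℝ-commutativeRing = record { isCommutativeRing = ℝ-isCommutativeRing }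

infix 4 _+i_

record ℂ : Set where
  constructor _+i_
  field
    re im : ℝ

open ℂ public

infix  4 _≈ᶜ_ _,ᶜ_
infix  8 -ᶜ_
infixl 7 _*ᶜ_
infixl 6 _+ᶜ_

record _≈ᶜ_ (z w : ℂ) : Set where
  constructor _,ᶜ_
  field
    re-≈ : re z ≈ᴿ re w
    im-≈ : im z ≈ᴿ im w

open _≈ᶜ_ public

_+ᶜ_ : ℂ → ℂ → ℂ
(z +ᶜ w) .re = re z +ᴿ re w
(z +ᶜ w) .im = im z +ᴿ im w

-ᶜ_ : ℂ → ℂ
(-ᶜ z) .re = -ᴿ re z
(-ᶜ z) .im = -ᴿ im z

_*ᶜ_ : ℂ → ℂ → ℂ
(z *ᶜ w) .re = re z *ᴿ re w +ᴿ -ᴿ (im z *ᴿ im w)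
(z *ᶜ w) .im = re z *ᴿ im w +ᴿ im z *ᴿ re w

0ᶜ 1ᶜ : ℂ
0ᶜ = fromℚ 0ℚ +i fromℚ 0ℚ
1ᶜ = fromℚ 1ℚ +i fromℚ 0ℚ

private
  *ᶜ-comm : ∀ z w → z *ᶜ w ≈ᶜ w *ᶜ z
  *ᶜ-comm (a +i b) (c +i d) =
    ≗⇒≈ (λ n → Rational.*-comm-re (seq a n) (seq b n) (seq c n) (seq d n)) ,ᶜ
    ≗⇒≈ (λ n → Rational.*-comm-im (seq a n) (seq b n) (seq c n) (seq d n))

  *ᶜ-assoc : ∀ z w u → (z *ᶜ w) *ᶜ u ≈ᶜ z *ᶜ (w *ᶜ u)
  *ᶜ-assoc (a +i b) (c +i d) (e +i f) =
    ≗⇒≈ (λ n → Rational.*-assoc-re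
      (seq a n) (seq b n) (seq c n) (seq d n) (seq e n) (seq f n)) ,ᶜ
    ≗⇒≈ (λ n → Rational.*-assoc-im
      (seq a n) (seq b n) (seq c n) (seq d n) (seq e n) (seq f n))

  *ᶜ-identityˡ : ∀ z → 1ᶜ *ᶜ z ≈ᶜ z
  *ᶜ-identityˡ (a +i b) =
    ≗⇒≈ (λ n → Rational.*-identity-re (seq a n) (seq b n)) ,ᶜ
    ≗⇒≈ (λ n → Rational.*-identity-im (seq a n) (seq b n))

  *ᶜ-distribˡ : ∀ z w u → z *ᶜ (w +ᶜ u) ≈ᶜ z *ᶜ w +ᶜ z *ᶜ u
  *ᶜ-distribˡ (a +i b) (c +i d) (e +i f) =
    ≗⇒≈ (λ n → Rational.*-distrib-re
      (seq a n) (seq b n) (seq c n) (seq d n) (seq e n) (seq f n)) ,ᶜ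
    ≗⇒≈ (λ n → Rational.*-distrib-im
      (seq a n) (seq b n) (seq c n) (seq d n) (seq e n) (seq f n))

  module R = CommutativeRing ℝ-commutativeRing

  ≈ᶜ-isEquivalence : IsEquivalence _≈ᶜ_
  ≈ᶜ-isEquivalence = record
    { refl  = R.refl ,ᶜ R.refl
    ; sym   = λ (p ,ᶜ r) → R.sym p ,ᶜ R.sym r
    ; trans = λ (p ,ᶜ r) (p′ ,ᶜ r′) → R.trans p p′ ,ᶜ R.trans r r′
    }

  +ᶜ-cong : ∀ {z z′ w w′} → z ≈ᶜ z′ → w ≈ᶜ w′ → z +ᶜ w ≈ᶜ z′ +ᶜ w′
  +ᶜ-cong (p ,ᶜ r) (p′ ,ᶜ r′) = R.+-cong p p′ ,ᶜ R.+-cong r r′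

  *ᶜ-cong : ∀ {z z′ w w′} → z ≈ᶜ z′ → w ≈ᶜ w′ → z *ᶜ w ≈ᶜ z′ *ᶜ w′
  *ᶜ-cong (p ,ᶜ r) (p′ ,ᶜ r′) =
    R.+-cong (R.*-cong p p′) (R.-‿cong (R.*-cong r r′)) ,ᶜ
    R.+-cong (R.*-cong p r′) (R.*-cong r p′)

  module E = IsEquivalence ≈ᶜ-isEquivalence

ℂ-isCommutativeRing : IsCommutativeRing _≈ᶜ_ _+ᶜ_ _*ᶜ_ -ᶜ_ 0ᶜ 1ᶜ
ℂ-isCommutativeRing = record
  { isRing = record
    { +-isAbelianGroup = record
      { isGroup = record
        { isMonoid = record
          { isSemigroup = record
            { isMagma = record { isEquivalence = ≈ᶜ-isEquivalence ; ∙-cong = +ᶜ-cong }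
            ; assoc = λ z w u → R.+-assoc (re z) (re w) (re u) ,ᶜ R.+-assoc (im z) (im w) (im u)
            }
          ; identity = (λ z → R.+-identityˡ (re z) ,ᶜ R.+-identityˡ (im z))
                     , (λ z → R.+-identityʳ (re z) ,ᶜ R.+-identityʳ (im z))
          }
        ; inverse = (λ z → R.-‿inverseˡ (re z) ,ᶜ R.-‿inverseˡ (im z))
                  , (λ z → R.-‿inverseʳ (re z) ,ᶜ R.-‿inverseʳ (im z))
        ; ⁻¹-cong = λ (p ,ᶜ r) → R.-‿cong p ,ᶜ R.-‿cong r
        }
      ; comm = λ z w → R.+-comm (re z) (re w) ,ᶜ R.+-comm (im z) (im w)
      }
    ; *-cong = *ᶜ-cong
    ; *-assoc = *ᶜ-assoc
    ; *-identity = *ᶜ-identityˡ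
                 , (λ z → E.trans (*ᶜ-comm z 1ᶜ) (*ᶜ-identityˡ z))
    ; distrib = *ᶜ-distribˡ
              , (λ z w u → E.trans (*ᶜ-comm (w +ᶜ u) z)
                   (E.trans (*ᶜ-distribˡ z w u) (+ᶜ-cong (*ᶜ-comm z w) (*ᶜ-comm z u))))
    }
  ; *-comm = *ᶜ-comm
  }

ℂ-commutativeRing : CommutativeRing 0ℓ 0ℓ
ℂ-commutativeRing = record { isCommutativeRing = ℂ-isCommutativeRing }

module _ (R : CommutativeRing c ℓ) where
  open CommutativeRing R
  open AlgebraDefinitions _≈_ using (Invertible)
  open import Relation.Binary.Reasoning.Setoid setoid

  private
    Unit : Set (c ⊔ ℓ)
    Unit = Σ Carrier (Invertible 1# _*_)

    cancel-middle : ∀ {a b x y} → a * b ≈ 1# → x * y ≈ 1# → (x * a) * (b * y) ≈ 1#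
    cancel-middle {a} {b} {x} {y} ab xy = begin
      (x * a) * (b * y)  ≈⟨ *-assoc x a (b * y) ⟩
      x * (a * (b * y))  ≈⟨ *-congˡ (*-assoc a b y) ⟨
      x * ((a * b) * y)  ≈⟨ *-congˡ (*-congʳ ab) ⟩
      x * (1# * y)       ≈⟨ *-congˡ (*-identityˡ y) ⟩
      x * y              ≈⟨ xy ⟩
      1#                 ∎

    _∙_ : Unit → Unit → Unit
    (x , x⁻¹ , x⁻¹x , xx⁻¹) ∙ (y , y⁻¹ , y⁻¹y , yy⁻¹) =
      x * y , y⁻¹ * x⁻¹ , cancel-middle x⁻¹x y⁻¹y , cancel-middle yy⁻¹ xx⁻¹

    inv : Unit → Unit
    inv (x , x⁻¹ , x⁻¹x , xx⁻¹) = x⁻¹ , x , xx⁻¹ , x⁻¹x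

    inv-cong : ∀ (u v : Unit) → proj₁ u ≈ proj₁ v → proj₁ (inv u) ≈ proj₁ (inv v)
    inv-cong (x , x⁻¹ , x⁻¹x , _) (y , y⁻¹ , _ , yy⁻¹) x≈y = begin
      x⁻¹              ≈⟨ *-identityʳ x⁻¹ ⟨
      x⁻¹ * 1#         ≈⟨ *-congˡ yy⁻¹ ⟨
      x⁻¹ * (y * y⁻¹)  ≈⟨ *-assoc x⁻¹ y y⁻¹ ⟨
      (x⁻¹ * y) * y⁻¹  ≈⟨ *-congʳ (*-congˡ x≈y) ⟨
      (x⁻¹ * x) * y⁻¹  ≈⟨ *-congʳ x⁻¹x ⟩
      1# * y⁻¹         ≈⟨ *-identityˡ y⁻¹ ⟩
      y⁻¹              ∎

  unitGroup : Group (c ⊔ ℓ) ℓ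
  unitGroup = record
    { Carrier = Unit
    ; _≈_     = λ u v → proj₁ u ≈ proj₁ v
    ; _∙_     = _∙_
    ; ε       = 1# , 1# , *-identityˡ 1# , *-identityˡ 1#
    ; _⁻¹     = inv
    ; isGroup = record
      { isMonoid = record
        { isSemigroup = record
          { isMagma = record
            { isEquivalence = record { refl = refl ; sym = sym ; trans = trans }
            ; ∙-cong = *-cong
            }
          ; assoc = λ u v w → *-assoc (proj₁ u) (proj₁ v) (proj₁ w)
          }
        ; identity = (λ u → *-identityˡ (proj₁ u)) , (λ u → *-identityʳ (proj₁ u))
        }
      ; inverse = (λ (_ , _ , x⁻¹x , _) → x⁻¹x) , (λ (_ , _ , _ , xx⁻¹) → xx⁻¹)
      ; ⁻¹-cong = λ {u} {v} → inv-cong u v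
      }
    }

-- Invertibility is the constructive reading of z ≠ 0 (apartness from 0);
-- classically the two agree.
ℂ* : Group 0ℓ 0ℓ
ℂ* = unitGroup ℂ-commutativeRing

module _ {q : ℕ} (F : FiniteField c ℓ q) where
  open FiniteField F

  AdditiveCharacter : Set (c ⊔ ℓ)
  AdditiveCharacter = GroupHomomorphism (Group.rawGroup +-group) (Group.rawGroup ℂ*)

  module _ (χ : AdditiveCharacter) where
    open GroupHomomorphism χ using (⟦_⟧)

    Nontrivial : Set c
    Nontrivial = ¬ (∀ v → Group._≈_ ℂ* ⟦ v ⟧ (Group.ε ℂ*))

    value : Carrier → ℂ
    value v = proj₁ ⟦ v ⟧

  sumOver : (Carrier → ℂ) → ℂ
  sumOver g = sum (λ i → g (element i))
    where open RawMonoidDefinitions (CommutativeRing.+-rawMonoid ℂ-commutativeRing) using (sum)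

{-# OPTIONS --safe #-}

-- Put S = ∑ᵥ χ(v).  Translating by a gives χ(a) S = S, so S ≠ 0 would force
-- χ to be trivial.  Hence ∑ᵥ χ(uv) = 0 for u ≠ 0, and a permutation g only
-- reorders the terms of ∑ᵥ χ(u g(v)).  Conversely, let these sums vanish and
-- suppose g misses b: the double sum ∑ᵤ ∑ᵥ χ(u(g(v) − b)) is then 0 when summed
-- over u first, but equals the order of the field when summed over v first.
-- So g is surjective, hence bijective.  Constructively, the first step uses
-- that equality with 0 in ℂ is ¬¬-stable.

module Submission where

open import Defs
open import Algebra.Bundles using (CommutativeRing)
open import Algebra.Morphism.Bundles using (GroupHomomorphism)
import Algebra.Properties.Group as GroupProperties
import Algebra.Properties.Ring as RingProperties
open import Algebra.Properties.Semiring.Sum (CommutativeRing.semiring ℂ-commutativeRing)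
  using (sum; sum-cong-≋; sum-remove; sum-replicate-zero; sum-permute; ∑-comm;
         *-distribˡ-sum; *-distribʳ-sum)
open import Data.Fin.Base using (Fin; punchOut)
open import Data.Fin.Properties using (_≟_; any?; injective⇒≤; punchInᵢ≢i; punchOut-injective)
open import Data.List.Base using ([]; _∷_)
open import Data.Nat.Base as ℕ using (ℕ; _^_; _≥_)
import Data.Nat.Properties as ℕ
open import Data.Product.Base using (∃; _×_; _,_; proj₁; proj₂)
open import Data.Rational.Base as ℚ using (0ℚ; 1ℚ; ½)
import Data.Rational.Properties as ℚ
open import Data.Rational.Solver using (module +-*-Solver)
open import Data.Sum.Base using (inj₁; inj₂)
open import Function.Base using (_∘_)
open import Function.Bundles using (Inverse; _⇔_; mk⇔)
import Function.Construct.Composition as Composition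
import Function.Construct.Symmetry as Symmetry
open import Function.Definitions using (Congruent; Injective; Bijective; StrictlySurjective)
open import Function.Properties.Bijection using (Bijection⇒Inverse)
open import Level using (Level)
import Relation.Binary.Reasoning.Setoid as SetoidReasoning
open import Relation.Binary.PropositionalEquality as ≡ using (_≡_; _≢_; cong; cong₂; subst)
open import Relation.Nullary.Decidable using (yes; no)
open import Relation.Nullary.Negation using (¬_; contradiction)

module R = CommutativeRing ℝ-commutativeRing
module C = CommutativeRing ℂ-commutativeRing

-- Apartness and stable equality with zero in `ℝ`.

-- Apartness from 0, the positive form of x ≠ 0.
Away : ℝ → Set
Away x = ∃ λ ε → 0ℚ ℚ.< ε × ∃ λ N → ∀ n → N ℕ.≤ n → ε ℚ.≤ ℚ.∣ seq x n ∣

Away-mono : ∀ {x y} → (∀ n → ℚ.∣ seq x n ∣ ℚ.≤ ℚ.∣ seq y n ∣) → Away x → Away y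
Away-mono x≤y (ε , 0<ε , N , ε≤x) = ε , 0<ε , N , λ n N≤n → ℚ.≤-trans (ε≤x n N≤n) (x≤y n)

Away⇒≉0 : ∀ {x} → Away x → ¬ (x R.≈ R.0#)
Away⇒≉0 {x} (ε , 0<ε , N , ε≤x) x≈0 with converge x≈0 ε 0<ε
... | M , x<ε = ℚ.<-irrefl ≡.refl (ℚ.<-≤-trans
  (subst (λ p → ℚ.∣ p ∣ ℚ.< ε) (ℚ.+-identityʳ (seq x n)) (x<ε n (ℕ.m≤n⊔m N M)))
  (ε≤x n (ℕ.m≤m⊔n N M)))
  where n = N ℕ.⊔ M

-- A single term far enough along the Cauchy sequence decides the matter, and comparing rationals is
-- decidable: a small term keeps the whole tail small, a large one keeps the tail away from 0.
¬Away⇒≈0 : ∀ {x} → ¬ Away x → x R.≈ R.0#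
¬Away⇒≈0 {x} ¬away = mk≈ near
  where
  open ℚ.≤-Reasoning
  open +-*-Solver

  split : ∀ p q → ℚ.∣ p ∣ ℚ.≤ ℚ.∣ q ∣ ℚ.+ ℚ.∣ p ℚ.- q ∣
  split p q = subst (λ r → ℚ.∣ r ∣ ℚ.≤ ℚ.∣ q ∣ ℚ.+ ℚ.∣ p ℚ.- q ∣)
    (solve 2 (λ p q → q :+ (p :- q) := p) ≡.refl p q) (ℚ.∣p+q∣≤∣p∣+∣q∣ q (p ℚ.- q))

  near : ∀ ε → 0ℚ ℚ.< ε → ∃ λ N → ∀ n → N ℕ.≤ n → ℚ.∣ seq x n ℚ.- 0ℚ ∣ ℚ.< ε
  -- A quarter of `ε` serves both cases: a half plus a quarter stays below `ε`, while a later term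
  -- below a quarter would force the term at `N` below a half.
  near ε 0<ε with cauchy x (½ ℚ.* (½ ℚ.* ε)) (half-pos (half-pos 0<ε))
  ... | N , close with ℚ.∣ seq x N ∣ ℚ.<? ½ ℚ.* ε
  ... | yes small = N , λ n N≤n → begin-strict
    ℚ.∣ seq x n ℚ.- 0ℚ ∣                          ≡⟨ cong ℚ.∣_∣ (ℚ.+-identityʳ (seq x n)) ⟩
    ℚ.∣ seq x n ∣                                 ≤⟨ split (seq x n) (seq x N) ⟩
    ℚ.∣ seq x N ∣ ℚ.+ ℚ.∣ seq x n ℚ.- seq x N ∣   <⟨ ℚ.+-mono-< small (close n N N≤n ℕ.≤-refl) ⟩
    ½ ℚ.* ε ℚ.+ ½ ℚ.* (½ ℚ.* ε)                   ≤⟨ ℚ.+-monoʳ-≤ (½ ℚ.* ε) (p≤p+q _ _ (ℚ.<⇒≤ (half-pos (half-pos 0<ε)))) ⟩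
    ½ ℚ.* ε ℚ.+ (½ ℚ.* (½ ℚ.* ε) ℚ.+ ½ ℚ.* (½ ℚ.* ε)) ≡⟨ cong (½ ℚ.* ε ℚ.+_) (half+half (½ ℚ.* ε)) ⟩
    ½ ℚ.* ε ℚ.+ ½ ℚ.* ε                           ≡⟨ half+half ε ⟩
    ε                                             ∎
  ... | no large = contradiction
    (½ ℚ.* (½ ℚ.* ε) , half-pos (half-pos 0<ε) , N , λ n N≤n → ℚ.≮⇒≥ λ xₙ<δ →
      large (begin-strict
        ℚ.∣ seq x N ∣                                ≤⟨ split (seq x N) (seq x n) ⟩
        ℚ.∣ seq x n ∣ ℚ.+ ℚ.∣ seq x N ℚ.- seq x n ∣  <⟨ ℚ.+-mono-< xₙ<δ (close N n ℕ.≤-refl N≤n) ⟩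
        ½ ℚ.* (½ ℚ.* ε) ℚ.+ ½ ℚ.* (½ ℚ.* ε)          ≡⟨ half+half (½ ℚ.* ε) ⟩
        ½ ℚ.* ε                                      ∎))
    ¬away

-- Vanishing is equivalent to the negation of `Away`, and negations are stable.
≈0-stable : ∀ {x} → ¬ ¬ (x R.≈ R.0#) → x R.≈ R.0#
≈0-stable ¬¬x≈0 = ¬Away⇒≈0 (¬¬x≈0 ∘ Away⇒≉0)

Away-* : ∀ x y → Away x → Away y → Away (x R.* y)
Away-* x y (ε , 0<ε , M , ε≤x) (δ , 0<δ , N , δ≤y) =
  ε ℚ.* δ , ℚ.positive⁻¹ (ε ℚ.* δ) {{ℚ.pos*pos⇒pos ε δ}} , M ℕ.⊔ N , λ n M⊔N≤n → begin
    ε ℚ.* δ                          ≤⟨ ℚ.*-monoˡ-≤-nonNeg ε {{ℚ.pos⇒nonNeg ε}} (δ≤y n (ℕ.m⊔n≤o⇒n≤o M N M⊔N≤n)) ⟩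
    ε ℚ.* ℚ.∣ seq y n ∣               ≤⟨ ℚ.*-monoʳ-≤-nonNeg ℚ.∣ seq y n ∣ {{ℚ.∣-∣-nonNeg (seq y n)}} (ε≤x n (ℕ.m⊔n≤o⇒m≤o M N M⊔N≤n)) ⟩
    ℚ.∣ seq x n ∣ ℚ.* ℚ.∣ seq y n ∣   ≡⟨ ℚ.∣p*q∣≡∣p∣*∣q∣ (seq x n) (seq y n) ⟨
    ℚ.∣ seq x n ℚ.* seq y n ∣         ∎
  where
  open ℚ.≤-Reasoning
  instance
    ε-pos = ℚ.positive 0<ε
    δ-pos = ℚ.positive 0<δ

0≤p*p : ∀ p → 0ℚ ℚ.≤ p ℚ.* p
0≤p*p p = subst (0ℚ ℚ.≤_) (∣p∣*∣p∣≡p*p (ℚ.∣p∣≡p∨∣p∣≡-p p))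
  (ℚ.nonNegative⁻¹ _ {{ℚ.nonNeg*nonNeg⇒nonNeg ℚ.∣ p ∣ {{nn}} ℚ.∣ p ∣ {{nn}}}})
  where
  open +-*-Solver
  nn = ℚ.∣-∣-nonNeg p
  ∣p∣*∣p∣≡p*p : _ → ℚ.∣ p ∣ ℚ.* ℚ.∣ p ∣ ≡ p ℚ.* p
  ∣p∣*∣p∣≡p*p (inj₁ e) = cong₂ ℚ._*_ e e
  ∣p∣*∣p∣≡p*p (inj₂ e) = ≡.trans (cong₂ ℚ._*_ e e)
    (solve 1 (λ p → :- p :* :- p := p :* p) ≡.refl p)

∣p∣≤∣p+q∣ : ∀ {p q} → 0ℚ ℚ.≤ p → 0ℚ ℚ.≤ q → ℚ.∣ p ∣ ℚ.≤ ℚ.∣ p ℚ.+ q ∣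
∣p∣≤∣p+q∣ {p} {q} 0≤p 0≤q = begin
  ℚ.∣ p ∣        ≡⟨ ℚ.0≤p⇒∣p∣≡p 0≤p ⟩
  p              ≤⟨ p≤p+q p q 0≤q ⟩
  p ℚ.+ q        ≡⟨ ℚ.0≤p⇒∣p∣≡p (ℚ.+-mono-≤ 0≤p 0≤q) ⟨
  ℚ.∣ p ℚ.+ q ∣  ∎
  where open ℚ.≤-Reasoning

-- Zero products and stability in `ℂ`.

modulus² : ℂ → ℝ
modulus² z = re z R.* re z R.+ im z R.* im z

-- Each squared coordinate is termwise at most `modulus² z`, so a coordinate apart from 0 would keep
-- `modulus² z` apart from 0.
modulus²≈0⇒≈0 : ∀ {z} → modulus² z R.≈ R.0# → z C.≈ C.0#
modulus²≈0⇒≈0 {z@(a +i b)} n≈0 =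
  ¬Away⇒≈0 (λ a# → Away⇒≉0 (Away-mono {a R.* a} {modulus² z}
    (λ n → ∣p∣≤∣p+q∣ (0≤p*p (seq a n)) (0≤p*p (seq b n))) (Away-* a a a# a#)) n≈0) ,ᶜ
  ¬Away⇒≈0 (λ b# → Away⇒≉0 (Away-mono {b R.* b} {modulus² z}
    (λ n → subst (λ p → _ ℚ.≤ ℚ.∣ p ∣) (ℚ.+-comm (seq b n ℚ.* seq b n) _)
      (∣p∣≤∣p+q∣ (0≤p*p (seq b n)) (0≤p*p (seq a n)))) (Away-* b b b# b#)) n≈0)

*ᴿ-zero-product : ∀ {x y} → x R.* y R.≈ R.0# → ¬ (x R.≈ R.0#) → y R.≈ R.0#
*ᴿ-zero-product {x} {y} xy≈0 x≉0 =
  ¬Away⇒≈0 λ y# → x≉0 (¬Away⇒≈0 λ x# → Away⇒≉0 (Away-* x y x# y#) xy≈0)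

-- Multiplying `z w` by the conjugate of `z` gives `modulus² z` times `w`. `re-part` and `im-part`
-- are the two coordinates of this identity, which reduce the claim to real zero products.
*ᶜ-zero-product : ∀ {z w} → z C.* w C.≈ C.0# → ¬ (z C.≈ C.0#) → w C.≈ C.0#
*ᶜ-zero-product {a +i b} {c +i d} (re≈0 ,ᶜ im≈0) z≉0 =
  *ᴿ-zero-product (R.trans re-part (vanish re≈0 im≈0)) ∣z∣²≉0 ,ᶜ
  *ᴿ-zero-product (R.trans im-part (vanish im≈0 (R.trans (R.-‿cong re≈0) (RingProperties.-0#≈0# R.ring)))) ∣z∣²≉0
  where
  open +-*-Solver
  zw = (a +i b) C.* (c +i d)

  ∣z∣²≉0 : ¬ (modulus² (a +i b) R.≈ R.0#)
  ∣z∣²≉0 = z≉0 ∘ modulus²≈0⇒≈0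

  vanish : ∀ {x y} → x R.≈ R.0# → y R.≈ R.0# → a R.* x R.+ b R.* y R.≈ R.0#
  vanish x≈0 y≈0 = R.trans
    (R.+-cong (R.trans (R.*-congˡ x≈0) (R.zeroʳ a)) (R.trans (R.*-congˡ y≈0) (R.zeroʳ b)))
    (R.+-identityˡ R.0#)

  re-part : modulus² (a +i b) R.* c R.≈ a R.* re zw R.+ b R.* im zw
  re-part = ≗⇒≈ λ n → solve 4 (λ a b c d →
    (a :* a :+ b :* b) :* c := a :* (a :* c :- b :* d) :+ b :* (a :* d :+ b :* c))
    ≡.refl (seq a n) (seq b n) (seq c n) (seq d n)

  im-part : modulus² (a +i b) R.* d R.≈ a R.* im zw R.+ b R.* (R.- re zw)
  im-part = ≗⇒≈ λ n → solve 4 (λ a b c d →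
    (a :* a :+ b :* b) :* d := a :* (a :* d :+ b :* c) :+ b :* (:- (a :* c :- b :* d)))
    ≡.refl (seq a n) (seq b n) (seq c n) (seq d n)

≈0ᶜ-stable : ∀ {z} → ¬ ¬ (z C.≈ C.0#) → z C.≈ C.0#
≈0ᶜ-stable ¬¬z≈0 =
  ≈0-stable (λ re≉0 → ¬¬z≈0 (re≉0 ∘ re-≈)) ,ᶜ ≈0-stable (λ im≉0 → ¬¬z≈0 (im≉0 ∘ im-≈))

-- Finite sums in `ℂ`.

sum-zero : ∀ {n} {t : Fin n → ℂ} → (∀ i → t i C.≈ C.0#) → sum t C.≈ C.0#
sum-zero {n} t≈0 = C.trans (sum-cong-≋ t≈0) (sum-replicate-zero n)

sum-single : ∀ {n} (t : Fin n → ℂ) i → (∀ j → j ≢ i → t j C.≈ C.0#) → sum t C.≈ t i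
sum-single {ℕ.suc n} t i t≈0 = C.trans (sum-remove t)
  (C.trans (C.+-congˡ (sum-zero λ j → t≈0 _ (punchInᵢ≢i i j))) (C.+-identityʳ (t i)))

sum-ones-nonneg : ∀ n k → 0ℚ ℚ.≤ seq (re (sum {n} λ _ → C.1#)) k
sum-ones-nonneg ℕ.zero    k = ℚ.≤-refl
sum-ones-nonneg (ℕ.suc n) k = ℚ.+-mono-≤ (ℚ.<⇒≤ 0<1) (sum-ones-nonneg n k)

-- This is characteristic zero: every term of the sequence for the real part is 1 plus a nonnegative
-- rational. The element of `Fin n` excludes the empty sum.
sum-ones≉0 : ∀ {n} → Fin n → ¬ (sum {n} (λ _ → C.1#) C.≈ C.0#)
sum-ones≉0 {ℕ.suc n} _ s≈0 = Away⇒≉0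
  (1ℚ , 0<1 , 0 , λ k _ → ∣p∣≤∣p+q∣ (ℚ.<⇒≤ 0<1) (sum-ones-nonneg n k)) (re-≈ s≈0)

-- Self-maps of a finite set.

-- Pigeonhole: deleting a missed value from the codomain would inject a set of size `suc n` into one
-- of size `n`.
injective⇒surjective : ∀ {n} {h : Fin n → Fin n} → Injective _≡_ _≡_ h → StrictlySurjective _≡_ h
injective⇒surjective {ℕ.suc n} {h} inj y with any? (λ x → h x ≟ y)
... | yes hit  = hit
... | no  miss = contradiction
  (injective⇒≤ {f = λ x → punchOut (y≢h x)} (inj ∘ punchOut-injective (y≢h _) (y≢h _))) ℕ.1+n≰n
  where
  y≢h : ∀ x → y ≢ h x
  y≢h x y≡hx = miss (x , ≡.sym y≡hx)

-- Chosen preimages form an injective section `s`. It is then surjective too, which makes it a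
-- two-sided inverse of `h`.
surjective⇒injective : ∀ {n} {h : Fin n → Fin n} → StrictlySurjective _≡_ h → Injective _≡_ _≡_ h
surjective⇒injective {h = h} surj {i} {j} hi≡hj = ≡.trans (≡.sym (s∘h i)) (≡.trans (cong s hi≡hj) (s∘h j))
  where
  s = proj₁ ∘ surj

  h∘s : ∀ y → h (s y) ≡ y
  h∘s = proj₂ ∘ surj

  s-injective : Injective _≡_ _≡_ s
  s-injective {x} {y} e = ≡.trans (≡.sym (h∘s x)) (≡.trans (cong h e) (h∘s y))

  s∘h : ∀ i → s (h i) ≡ i
  s∘h i with injective⇒surjective s-injective i
  ... | y , ≡.refl = cong s (h∘s y)

private
  variable
    c ℓ : Level

-- Bijections of a finite field and reindexing of sums.

module FiniteFieldProperties {q : ℕ} (F : FiniteField c ℓ q) where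
  open FiniteField F
  open Inverse enumeration using (from; from-cong)
  open SetoidReasoning setoid

  element-from : ∀ v → element (from v) ≈ v
  element-from = Inverse.strictlyInverseˡ enumeration

  from-element : ∀ i → from (element i) ≡ i
  from-element = Inverse.strictlyInverseʳ enumeration

  eval-cong : ∀ f → Congruent _≈_ _≈_ (eval F f)
  eval-cong []      v≈w = refl
  eval-cong (a ∷ f) v≈w = +-congˡ (*-cong v≈w (eval-cong f v≈w))

  translation : Carrier → Inverse setoid setoid
  translation a = record
    { to        = a +_
    ; from      = - a +_
    ; to-cong   = +-congˡ
    ; from-cong = +-congˡ
    ; inverse   = (λ {x} y≈ → trans (+-congˡ y≈) (\\-leftDividesˡ a x))
                , (λ {x} y≈ → trans (+-congˡ y≈) (\\-leftDividesʳ a x))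
    }
    where open GroupProperties +-group

  scaling : ∀ u → ¬ (u ≈ 0#) → Inverse setoid setoid
  scaling u u≉0 with ≉0⇒invertible u u≉0
  ... | u⁻¹ , u⁻¹u , uu⁻¹ = record
    { to        = u *_
    ; from      = u⁻¹ *_
    ; to-cong   = *-congˡ
    ; from-cong = *-congˡ
    ; inverse   = (λ y≈ → trans (*-congˡ y≈) (cancel uu⁻¹))
                , (λ y≈ → trans (*-congˡ y≈) (cancel u⁻¹u))
    }
    where
    cancel : ∀ {a b x} → a * b ≈ 1# → a * (b * x) ≈ x
    cancel {a} {b} {x} ab≈1 = trans (sym (*-assoc a b x)) (trans (*-congʳ ab≈1) (*-identityˡ x))

  -- Conjugation by the enumeration turns `h` into a permutation `π` of the indices. Since `element`
  -- undoes `from` only up to `≈`, `g` has to be a congruence.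
  sumOver-reindex : ∀ {g} → Congruent _≈_ C._≈_ g → (h : Inverse setoid setoid) →
    sumOver F (g ∘ Inverse.to h) C.≈ sumOver F g
  sumOver-reindex {g} g-cong h = C.sym (C.trans (sum-permute (g ∘ element) π)
    (sum-cong-≋ λ i → g-cong (element-from (Inverse.to h (element i)))))
    where
    π = Composition.inverse (Composition.inverse enumeration h) (Symmetry.inverse enumeration)

  -- The hypothesis gives no preimages, only that no value is missed. Transported to `Fin q`, where
  -- equality is decidable, an exhaustive search finds them, and finiteness then yields injectivity.
  surjective⇒bijective : ∀ {g} → Congruent _≈_ _≈_ g →
    (∀ b → ¬ (∀ v → ¬ (g v ≈ b))) → Bijective _≈_ _≈_ g
  surjective⇒bijective {g} g-cong hits = injective , surjective
    where
    ĝ : Fin q → Fin q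
    ĝ = from ∘ g ∘ element

    from-injective : ∀ {v w} → from v ≡ from w → v ≈ w
    from-injective {v} {w} e = begin
      v                 ≈⟨ element-from v ⟨
      element (from v)  ≡⟨ cong element e ⟩
      element (from w)  ≈⟨ element-from w ⟩
      w                 ∎

    ĝ-surjective : StrictlySurjective _≡_ ĝ
    ĝ-surjective j with any? (λ i → ĝ i ≟ j)
    ... | yes hit  = hit
    ... | no  miss = contradiction
      (λ v gv≈ → miss (from v , ≡.trans (from-cong (trans (g-cong (element-from v)) gv≈)) (from-element j)))
      (hits (element j))

    injective : ∀ {v w} → g v ≈ g w → v ≈ w
    injective {v} {w} gv≈gw = from-injective (surjective⇒injective ĝ-surjective (from-cong (begin
      g (element (from v))  ≈⟨ g-cong (element-from v) ⟩
      g v                   ≈⟨ gv≈gw ⟩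
      g w                   ≈⟨ g-cong (element-from w) ⟨
      g (element (from w))  ∎)))

    surjective : ∀ b → ∃ λ v → ∀ {w} → w ≈ v → g w ≈ b
    surjective b with ĝ-surjective (from b)
    ... | i , ĝi≡ = element i , λ w≈ → trans (g-cong w≈) (from-injective ĝi≡)

-- Character sums over a finite field.

module CharacterSums {q : ℕ} (F : FiniteField c ℓ q)
  (χ : AdditiveCharacter F) (χ≢1 : Nontrivial F χ) where
  open FiniteField F
  open FiniteFieldProperties F
  open Inverse enumeration using (from; from-cong)
  open GroupHomomorphism χ using (⟦⟧-cong; homo; ε-homo)
  open SetoidReasoning C.setoid

  val : Carrier → ℂ
  val = value F χ

  val-cong : Congruent _≈_ C._≈_ val
  val-cong = ⟦⟧-cong

  val-+ : ∀ v w → val (v + w) C.≈ val v C.* val w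
  val-+ = homo

  -- `Nontrivial` supplies no particular `a` with a value other than 1. Assuming `S` nonzero
  -- therefore cancels it from `absorb a` for every `a` at once, and stability removes the double
  -- negation.
  sum-character : sumOver F val C.≈ C.0#
  sum-character = ≈0ᶜ-stable λ S≉0 → χ≢1 λ a →
    GroupProperties.x∙y⁻¹≈ε⇒x≈y C.+-group (val a) C.1# (*ᶜ-zero-product (absorb a) S≉0)
    where
    S = sumOver F val

    shift : ∀ a → val a C.* S C.≈ S
    shift a = begin
      val a C.* S                         ≈⟨ *-distribˡ-sum (val a) (val ∘ element) ⟩
      sumOver F (λ v → val a C.* val v)   ≈⟨ sum-cong-≋ (λ i → val-+ a (element i)) ⟨
      sumOver F (λ v → val (a + v))       ≈⟨ sumOver-reindex val-cong (translation a) ⟩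
      S                                   ∎

    absorb : ∀ a → S C.* (val a C.+ C.- C.1#) C.≈ C.0#
    absorb a = begin
      S C.* (val a C.+ C.- C.1#)            ≈⟨ C.distribˡ S (val a) (C.- C.1#) ⟩
      S C.* val a C.+ S C.* (C.- C.1#)      ≈⟨ C.+-cong (C.trans (C.*-comm S (val a)) (shift a))
                                                       (C.sym (RingProperties.-‿distribʳ-* C.ring S C.1#)) ⟩
      S C.+ C.- (S C.* C.1#)                ≈⟨ C.+-congˡ (C.-‿cong (C.*-identityʳ S)) ⟩
      S C.+ C.- S                           ≈⟨ C.-‿inverseʳ S ⟩
      C.0#                                  ∎

  sum-scaled : ∀ u → ¬ (u ≈ 0#) → sumOver F (λ v → val (u * v)) C.≈ C.0#
  sum-scaled u u≉0 = C.trans (sumOver-reindex val-cong (scaling u u≉0)) sum-character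

  module _ {g : Carrier → Carrier} (g-cong : Congruent _≈_ _≈_ g) where

    bijective⇒sums-vanish : Bijective _≈_ _≈_ g →
      ∀ u → ¬ (u ≈ 0#) → sumOver F (λ v → val (u * g v)) C.≈ C.0#
    bijective⇒sums-vanish bij u u≉0 = C.trans
      (sumOver-reindex (val-cong ∘ *-congˡ)
        (Bijection⇒Inverse (record { to = g ; cong = g-cong ; bijective = bij })))
      (sum-scaled u u≉0)

    sums-vanish⇒hits : (∀ u → ¬ (u ≈ 0#) → sumOver F (λ v → val (u * g v)) C.≈ C.0#) →
      ∀ b → ¬ (∀ v → ¬ (g v ≈ b))
    sums-vanish⇒hits vanish b missed = sum-ones≉0 (from 0#) (begin
      sum {q} (λ _ → C.1#)                                  ≈⟨ sum-cong-≋ (λ j → at-zero (element j)) ⟨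
      -- Only the row of `u = 0` survives, and all its terms are 1.
      sumOver F (λ v → term (element (from 0#)) v)          ≈⟨ sum-single _ (from 0#) (λ i → row (element i) ∘ nonzero i) ⟨
      sumOver F (λ u → sumOver F (λ v → term u v))          ≈⟨ ∑-comm (λ i j → term (element i) (element j)) ⟩
      sumOver F (λ v → sumOver F (λ u → term u v))          ≈⟨ sum-zero (λ j → column (element j)) ⟩
      C.0#                                                  ∎)
      where
      term : Carrier → Carrier → ℂ
      term u v = val (u * (g v + - b))

      nonzero : ∀ i → i ≢ from 0# → ¬ (element i ≈ 0#)
      nonzero i i≢ i≈0 = i≢ (≡.trans (≡.sym (from-element i)) (from-cong i≈0))

      at-zero : ∀ v → term (element (from 0#)) v C.≈ C.1#
      at-zero v = C.trans (val-cong (trans (*-congʳ (element-from 0#)) (zeroˡ _))) ε-homo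

      -- The shift by `b` contributes only the factor `val (u * - b)`, constant in `v`.
      row : ∀ u → ¬ (u ≈ 0#) → sumOver F (term u) C.≈ C.0#
      row u u≉0 = begin
        sumOver F (term u)                                       ≈⟨ sum-cong-≋ (λ j → C.trans (val-cong (distribˡ u (g (element j)) (- b))) (val-+ _ _)) ⟩
        sumOver F (λ v → val (u * g v) C.* val (u * - b))         ≈⟨ *-distribʳ-sum (val (u * - b)) (λ j → val (u * g (element j))) ⟨
        sumOver F (λ v → val (u * g v)) C.* val (u * - b)         ≈⟨ C.*-congʳ (vanish u u≉0) ⟩
        C.0# C.* val (u * - b)                                   ≈⟨ C.zeroˡ _ ⟩
        C.0#                                                     ∎

      -- As `b` is missed, `g v + - b` is nonzero and can act as the scaling factor for the sum over
      -- `u`.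
      column : ∀ v → sumOver F (λ u → term u v) C.≈ C.0#
      column v = C.trans (sum-cong-≋ (λ i → val-cong (*-comm (element i) _)))
        (sum-scaled (g v + - b) (missed v ∘ GroupProperties.x∙y⁻¹≈ε⇒x≈y +-group (g v) b))

theorem1 : {c₁ ℓ₁ c₂ ℓ₂ : Level} (q n : ℕ)
    (Fq : FiniteField c₁ ℓ₁ q) → HasCharacteristic (FiniteField.commutativeRing Fq) 2 →
    n ≥ 1 →
    (Fqⁿ : FiniteField c₂ ℓ₂ (q ^ n)) →
    (χ : AdditiveCharacter Fqⁿ) → Nontrivial Fqⁿ χ →
    (f : Polynomial Fqⁿ) →
    let open FiniteField Fqⁿ in
    IsPermutationPolynomial Fqⁿ f
    ⇔ (∀ u → ¬ (u ≈ 0#) → sumOver Fqⁿ (λ v → value Fqⁿ χ (u * eval Fqⁿ f v)) ≈ᶜ 0ᶜ)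
theorem1 q n Fq char2 n≥1 Fqⁿ χ χ≢1 f = mk⇔ (bijective⇒sums-vanish f-cong)
  (surjective⇒bijective f-cong ∘ sums-vanish⇒hits f-cong)
  where
  open FiniteFieldProperties Fqⁿ
  open CharacterSums Fqⁿ χ χ≢1
  f-cong = eval-cong f
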